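{- For every integer $n\ge 1$, $$\log^*n-\log^*\log^*n-1\;\le\; q_0(n)\;\le\;\log^*n+22.$$
   Context: Graphs are finite, simple, undirected, with non-empty vertex set. First order sentences about graphs use variables ranging over vertices, the relations $=$ and $\sim$ (adjacency), quantifiers $\forall,\exists$, connectives $\vee,\wedge,\neg$ and parentheses. A sentence $\Phi$ defines a graph $G$ if $\Phi$ is true on $G$ and false on every graph not isomorphic to $G$. The quantifier depth of a formula is the maximum number of nested quantifiers. A sentence is $0$-alternating if negations occur only directly in front of atomic formulas and no sequence of nested quantifiers contains a quantifier alternation (an occurrence of $\forall\exists$ or $\exists\forall$). $D_0(G)$ is the minimum quantifier depth of a $0$-alternating sentence defining $G$, and $q_0(n)=\min\{D_0(G): G \text{ a graph on } n \text{ vertices}\}$. $\log^*n$ is the minimum number of iterations of the binary logarithm needed to bring $n$ to $1$ or below (so $\log^* x=0$ for $x\le 1$). -}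

module Defs where

open import Data.Nat using (ℕ; zero; suc; _⊔_; _≤ᵇ_; _^_)
open import Data.Bool using (Bool; true; false; not; _∧_; _∨_; if_then_else_)
open import Data.Fin using (Fin)
import Data.Fin as Fin
open import Data.Vec using (Vec; []; _∷_; lookup)
open import Data.List.Base using (allFin)
import Data.Bool.ListAction as List
open import Relation.Nullary.Decidable using (⌊_⌋)
open import Relation.Nullary using (¬_)
open import Relation.Binary.PropositionalEquality using (_≡_)

record Graph (n : ℕ) : Set where
  field
    adj    : Fin n → Fin n → Bool
    sym    : ∀ u v → adj u v ≡ adj v u
    irrefl : ∀ u → adj u u ≡ false
open Graph public

record Iso {m n : ℕ} (H : Graph m) (G : Graph n) : Set where
  field
    to      : Fin m → Fin n
    from    : Fin n → Fin m
    from∘to : ∀ u → from (to u) ≡ u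
    to∘from : ∀ v → to (from v) ≡ v
    pres    : ∀ u v → adj H u v ≡ adj G (to u) (to v)
open Iso public

data Formula : ℕ → Set where
  eqᶠ  : ∀ {k} → Fin k → Fin k → Formula k
  adjᶠ : ∀ {k} → Fin k → Fin k → Formula k
  negᶠ : ∀ {k} → Formula k → Formula k
  andᶠ : ∀ {k} → Formula k → Formula k → Formula k
  orᶠ  : ∀ {k} → Formula k → Formula k → Formula k
  allᶠ : ∀ {k} → Formula (suc k) → Formula k
  exᶠ  : ∀ {k} → Formula (suc k) → Formula k

Sentence : Set
Sentence = Formula 0

eval : ∀ {n k} → Graph n → Formula k → Vec (Fin n) k → Bool
eval G (eqᶠ x y)   ρ = ⌊ lookup ρ x Fin.≟ lookup ρ y ⌋
eval G (adjᶠ x y)  ρ = adj G (lookup ρ x) (lookup ρ y)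
eval G (negᶠ φ)    ρ = not (eval G φ ρ)
eval G (andᶠ φ ψ)  ρ = eval G φ ρ ∧ eval G ψ ρ
eval G (orᶠ φ ψ)   ρ = eval G φ ρ ∨ eval G ψ ρ
eval {n} G (allᶠ φ) ρ = List.all (λ v → eval G φ (v ∷ ρ)) (allFin n)
eval {n} G (exᶠ φ)  ρ = List.any (λ v → eval G φ (v ∷ ρ)) (allFin n)

_⊨_ : ∀ {n} → Graph n → Sentence → Bool
G ⊨ Φ = eval G Φ []

depth : ∀ {k} → Formula k → ℕ
depth (eqᶠ _ _)  = 0
depth (adjᶠ _ _) = 0
depth (negᶠ φ)   = depth φ
depth (andᶠ φ ψ) = depth φ ⊔ depth ψ
depth (orᶠ φ ψ)  = depth φ ⊔ depth ψ
depth (allᶠ φ)   = suc (depth φ)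
depth (exᶠ φ)    = suc (depth φ)

data Literal {k : ℕ} : Formula k → Set where
  lit-eq     : ∀ x y → Literal (eqᶠ x y)
  lit-adj    : ∀ x y → Literal (adjᶠ x y)
  lit-negeq  : ∀ x y → Literal (negᶠ (eqᶠ x y))
  lit-negadj : ∀ x y → Literal (negᶠ (adjᶠ x y))

data Universal : ∀ {k} → Formula k → Set where
  u-lit : ∀ {k} {φ : Formula k} → Literal φ → Universal φ
  u-and : ∀ {k} {φ ψ : Formula k} → Universal φ → Universal ψ → Universal (andᶠ φ ψ)
  u-or  : ∀ {k} {φ ψ : Formula k} → Universal φ → Universal ψ → Universal (orᶠ φ ψ)
  u-all : ∀ {k} {φ : Formula (suc k)} → Universal φ → Universal (allᶠ φ)

data Existential : ∀ {k} → Formula k → Set where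
  e-lit : ∀ {k} {φ : Formula k} → Literal φ → Existential φ
  e-and : ∀ {k} {φ ψ : Formula k} → Existential φ → Existential ψ → Existential (andᶠ φ ψ)
  e-or  : ∀ {k} {φ ψ : Formula k} → Existential φ → Existential ψ → Existential (orᶠ φ ψ)
  e-ex  : ∀ {k} {φ : Formula (suc k)} → Existential φ → Existential (exᶠ φ)

-- negations only in front of atoms, and no ∀∃ / ∃∀ along any chain of
-- nested quantifiers: below a ∀ only ∀'s occur, below an ∃ only ∃'s.
data ZeroAlt : ∀ {k} → Formula k → Set where
  z-lit : ∀ {k} {φ : Formula k} → Literal φ → ZeroAlt φ
  z-and : ∀ {k} {φ ψ : Formula k} → ZeroAlt φ → ZeroAlt ψ → ZeroAlt (andᶠ φ ψ)
  z-or  : ∀ {k} {φ ψ : Formula k} → ZeroAlt φ → ZeroAlt ψ → ZeroAlt (orᶠ φ ψ)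
  z-all : ∀ {k} {φ : Formula (suc k)} → Universal φ → ZeroAlt (allᶠ φ)
  z-ex  : ∀ {k} {φ : Formula (suc k)} → Existential φ → ZeroAlt (exᶠ φ)

record Defines {n : ℕ} (Φ : Sentence) (G : Graph n) : Set where
  field
    true-on-G : G ⊨ Φ ≡ true
    false-off : ∀ m (H : Graph (suc m)) → ¬ Iso H G → H ⊨ Φ ≡ false

-- log* on naturals.
-- tower 0 = 1, tower (k+1) = 2 ^ tower k.  For real x, log* x ≤ k iff
-- x ≤ tower k, hence log* n = least k with n ≤ tower k.  Since
-- n ≤ tower n, searching k = 0..n suffices.

tower : ℕ → ℕ
tower zero    = 1
tower (suc k) = 2 ^ tower k

private
  search : ℕ → ℕ → ℕ → ℕ
  search n zero     k = k
  search n (suc f)  k = if n ≤ᵇ tower k then k else search n f (suc k)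

log* : ℕ → ℕ
log* n = search n n 0

{-# OPTIONS --safe #-}
module Submission where

-- Both bounds use the Ehrenfeucht game in which Spoiler makes all his moves in
-- one of the two graphs: G ≼[ d ] H says that Duplicator survives 1 + d rounds
-- played in G, and a 0-alternating sentence of depth 1 + d true on G is true on
-- H as soon as G ≼[ d ] H and H ≼[ d ] G.
--
-- Lower bound.  Choosing one vertex for each of the finitely many game types,
-- recursively for every position reached, gives a set of vertices of size
-- bounded by a tower; a vertex z outside it can be deleted with
-- G ≼[ d ] G ─ z ≼[ d ] G, so a definable graph has no such vertex.
--
-- Upper bound.  If every vertex of G is singled out in G by an existential
-- formula of depth d, then d + 2 rounds define G.  The graph consists of a
-- rigid base on 7 vertices, the only vertices lying in triangles, and of layers
-- above it: layer 0 is a pair of non-adjacent base vertices, and the vertices of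
-- layer i + 1 are joined to pairwise distinct non-empty subsets of layer i.
-- Seven moves single out the base vertices and each layer costs one further
-- move, while the sizes of the layers grow like a tower.

open import Defs hiding (sym)
open import Data.Bool using (Bool; true; false; not; _∧_; _∨_; if_then_else_; T)
import Data.Bool as Bool
import Data.Bool.ListAction as BoolList
open import Data.Bool.Properties using (¬-not; not-¬; not-involutive; ∨-comm; ∨-identityʳ)
open import Data.Fin using (Fin; zero; suc; _≟_; toℕ; fromℕ<; inject≤; combine; funToFin; finToFun; punchIn; punchOut)
import Data.Fin as Fin
open import Data.Fin.Patterns
open import Data.Fin.Properties using (any?; all?; pigeonhole; combine-injective; finToFun-funToFin; punchIn-injective; punchIn-punchOut; <⇒≢; ¬∀⟶∃¬; toℕ-fromℕ<; toℕ-inject≤; toℕ-injective; toℕ<n)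
open import Data.List.Base using (List; []; _∷_; length; concat; tabulate; allFin)
import Data.List.Base as List
open import Data.List.Membership.Propositional using (_∈_; _∉_)
open import Data.List.Membership.Propositional.Properties using (∈-concat⁺′; ∈-tabulate⁺; ∈-allFin)
open import Data.List.Properties using (length-++)
import Data.List.Relation.Unary.All as All
open import Data.List.Relation.Unary.All using (All; []; _∷_)
open import Data.List.Relation.Unary.Any using (here; there; index)
open import Data.List.Relation.Unary.Any.Properties using (lookup-index)
open import Data.Nat using (ℕ; zero; suc; pred; _+_; _*_; _^_; _≤_; _<_; _≤ᵇ_; _≡ᵇ_; _≤?_; _<?_; ⌊_/2⌋; z≤n; s≤s; s≤s⁻¹)
open import Data.Nat.Properties hiding (_≟_; <⇒≢)
import Data.Nat.Properties as ℕ
open import Data.Product using (Σ; ∃; _×_; _,_; proj₁; proj₂)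
open import Data.Sum using (_⊎_; inj₁; inj₂)
open import Data.Vec using (Vec; []; _∷_; lookup)
open import Function using (_∘_; id)
open import Relation.Binary.Definitions using (tri<; tri≈; tri>)
open import Relation.Binary.PropositionalEquality
open import Relation.Nullary using (¬_; Dec; yes; no; contradiction)
open import Relation.Nullary.Decidable using (⌊_⌋; from-yes; _×-dec_; _→-dec_)

private variable
  a b k l m n : ℕ

-- Boolean connectives and decidable tests.

∧-true⁻ : ∀ {x y} → x ∧ y ≡ true → x ≡ true × y ≡ true
∧-true⁻ {true} {true} refl = refl , refl

∧-true⁺ : ∀ {x y} → x ≡ true → y ≡ true → x ∧ y ≡ true
∧-true⁺ refl refl = refl

∨-true⁻ : ∀ {x y} → x ∨ y ≡ true → x ≡ true ⊎ y ≡ true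
∨-true⁻ {true}  _ = inj₁ refl
∨-true⁻ {false} p = inj₂ p

∨-true⁺ˡ : ∀ {x y} → x ≡ true → x ∨ y ≡ true
∨-true⁺ˡ refl = refl

∨-true⁺ʳ : ∀ {x y} → y ≡ true → x ∨ y ≡ true
∨-true⁺ʳ {true}  _ = refl
∨-true⁺ʳ {false} p = p

all-tabulate⁻ : ∀ {A : Set} (p : A → Bool) (f : Fin n → A) →
  BoolList.all p (tabulate f) ≡ true → ∀ i → p (f i) ≡ true
all-tabulate⁻ p f q zero    = proj₁ (∧-true⁻ q)
all-tabulate⁻ p f q (suc i) = all-tabulate⁻ p (f ∘ suc) (proj₂ (∧-true⁻ {p (f zero)} q)) i

all-tabulate⁺ : ∀ {A : Set} (p : A → Bool) (f : Fin n → A) →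
  (∀ i → p (f i) ≡ true) → BoolList.all p (tabulate f) ≡ true
all-tabulate⁺ {zero}  p f q = refl
all-tabulate⁺ {suc n} p f q = ∧-true⁺ (q zero) (all-tabulate⁺ p (f ∘ suc) (q ∘ suc))

any-tabulate⁻ : ∀ {A : Set} (p : A → Bool) (f : Fin n → A) →
  BoolList.any p (tabulate f) ≡ true → ∃ λ i → p (f i) ≡ true
any-tabulate⁻ {suc n} p f q with ∨-true⁻ {p (f zero)} q
... | inj₁ h = zero , h
... | inj₂ h = let i , r = any-tabulate⁻ p (f ∘ suc) h in suc i , r

any-tabulate⁺ : ∀ {A : Set} (p : A → Bool) (f : Fin n → A) (i : Fin n) →
  p (f i) ≡ true → BoolList.any p (tabulate f) ≡ true
any-tabulate⁺ p f zero    q = ∨-true⁺ˡ q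
any-tabulate⁺ p f (suc i) q = ∨-true⁺ʳ {p (f zero)} (any-tabulate⁺ p (f ∘ suc) i q)

⌊⌋-yes : ∀ {A : Set} (A? : Dec A) → A → ⌊ A? ⌋ ≡ true
⌊⌋-yes (yes _) _ = refl
⌊⌋-yes (no ¬p) p = contradiction p ¬p

⌊⌋-true : ∀ {A : Set} (A? : Dec A) → ⌊ A? ⌋ ≡ true → A
⌊⌋-true (yes p) _ = p

≟-refl : (u : Fin n) → ⌊ u ≟ u ⌋ ≡ true
≟-refl u = ⌊⌋-yes (u ≟ u) refl

≟-true : {u v : Fin n} → ⌊ u ≟ v ⌋ ≡ true → u ≡ v
≟-true {u = u} {v} = ⌊⌋-true (u ≟ v)

-- One-sided Ehrenfeucht games

SameAtoms : (G : Graph n) (H : Graph m) (u v : Fin n) (x y : Fin m) → Set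
SameAtoms G H u v x y = ⌊ u ≟ v ⌋ ≡ ⌊ x ≟ y ⌋ × adj G u v ≡ adj H x y

same-≡⇒ : {G : Graph n} {H : Graph m} {u v : Fin n} {x y : Fin m} →
  SameAtoms G H u v x y → u ≡ v → x ≡ y
same-≡⇒ (p , _) refl = ≟-true (trans (sym p) (≟-refl _))

same-≡⇐ : {G : Graph n} {H : Graph m} {u v : Fin n} {x y : Fin m} →
  SameAtoms G H u v x y → x ≡ y → u ≡ v
same-≡⇐ (p , _) refl = ≟-true (trans p (≟-refl _))

Match : (G : Graph n) (H : Graph m) → Vec (Fin n) k → Vec (Fin m) k → Set
Match G H ρ σ = ∀ i j → SameAtoms G H (lookup ρ i) (lookup ρ j) (lookup σ i) (lookup σ j)

-- Sim G H d ρ σ: Duplicator survives d more rounds from position (ρ , σ)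
-- when Spoiler always moves in G.
Sim : (G : Graph n) (H : Graph m) → ℕ → Vec (Fin n) k → Vec (Fin m) k → Set
Sim G H zero    ρ σ = Match G H ρ σ
Sim G H (suc d) ρ σ = Match G H ρ σ × (∀ v → ∃ λ w → Sim G H d (v ∷ ρ) (w ∷ σ))

-- Spoiler has 1 + d moves here, not d.
_≼[_]_ : Graph n → ℕ → Graph m → Set
G ≼[ d ] H = ∀ v → ∃ λ w → Sim G H d (v ∷ []) (w ∷ [])

module _ {G : Graph n} {H : Graph m} where

  sim⇒match : ∀ d {ρ : Vec (Fin n) k} {σ} → Sim G H d ρ σ → Match G H ρ σ
  sim⇒match zero    s = s
  sim⇒match (suc d) s = proj₁ s

  sim-weaken : ∀ d {ρ : Vec (Fin n) k} {σ} → Sim G H (suc d) ρ σ → Sim G H d ρ σ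
  sim-weaken zero    s       = proj₁ s
  sim-weaken (suc d) (p , s) = p , λ v → let w , t = s v in w , sim-weaken d t

  sim-project : ∀ d (ι : Fin l → Fin k) {ρ : Vec (Fin n) k} {σ} {ρ′ : Vec (Fin n) l} {σ′} →
    (∀ i → lookup ρ′ i ≡ lookup ρ (ι i)) → (∀ i → lookup σ′ i ≡ lookup σ (ι i)) →
    Sim G H d ρ σ → Sim G H d ρ′ σ′
  sim-project {l} {k} d ι {ρ} {σ} {ρ′} {σ′} eρ eσ = go d
    where
    match : Match G H ρ σ → Match G H ρ′ σ′
    match s i j rewrite eρ i | eρ j | eσ i | eσ j = s (ι i) (ι j)
    ι↑ : Fin (suc l) → Fin (suc k)
    ι↑ zero    = zero
    ι↑ (suc i) = suc (ι i)
    go : ∀ d → Sim G H d ρ σ → Sim G H d ρ′ σ′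
    go zero    s       = match s
    go (suc d) (p , s) = match p , λ v → let w , t = s v in w ,
      sim-project d ι↑ (λ { zero → refl ; (suc i) → eρ i }) (λ { zero → refl ; (suc i) → eσ i }) t

  sim-head : ∀ d {v w} {ρ : Vec (Fin n) k} {σ} →
    Sim G H d (v ∷ ρ) (w ∷ σ) → Sim G H d (v ∷ []) (w ∷ [])
  sim-head d = sim-project d (λ { zero → zero }) (λ { zero → refl }) (λ { zero → refl })

  -- Spoiler may fix his moves in advance and ignore the replies. Duplicator's survival then becomes
  -- a map `h` on the listed vertices that preserves atoms among them and against the starting
  -- position.
  play : ∀ e (g : Fin e → Fin n) {ρ : Vec (Fin n) k} {σ} → Sim G H e ρ σ →
    ∃ λ (h : Fin e → Fin m) →
            (∀ i j → SameAtoms G H (g i) (g j) (h i) (h j)) ×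
            (∀ i j → SameAtoms G H (g i) (lookup ρ j) (h i) (lookup σ j)) ×
            Match G H ρ σ
  play zero    g s       = (λ ()) , (λ ()) , (λ ()) , s
  play (suc e) g {ρ} {σ} (p , s) = h′ , q₁ , q₂ , p
    where
    w = proj₁ (s (g zero))
    rest = play e (g ∘ suc) (proj₂ (s (g zero)))
    h = proj₁ rest
    r₁ = proj₁ (proj₂ rest)
    r₂ = proj₁ (proj₂ (proj₂ rest))
    r₃ = proj₂ (proj₂ (proj₂ rest))
    h′ : Fin (suc e) → Fin m
    h′ zero    = w
    h′ (suc i) = h i
    flip : ∀ {u v x y} → SameAtoms G H u v x y → SameAtoms G H v u y x
    flip {u} {v} {x} {y} (a , b) =
      ≟-flip , trans (Graph.sym G v u) (trans b (Graph.sym H x y))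
      where
      ≟-flip : ⌊ v ≟ u ⌋ ≡ ⌊ y ≟ x ⌋
      ≟-flip with v ≟ u | y ≟ x
      ... | yes _  | yes _  = refl
      ... | no _   | no _   = refl
      ... | yes r  | no  y≢x = contradiction (sym (same-≡⇒ {G = G} {H} (a , b) (sym r))) y≢x
      ... | no v≢u | yes r  = contradiction (sym (same-≡⇐ {G = G} {H} (a , b) (sym r))) v≢u
    q₁ : ∀ i j → SameAtoms G H (g i) (g j) (h′ i) (h′ j)
    q₁ zero    zero    = r₃ zero zero
    q₁ zero    (suc j) = flip (r₂ j zero)
    q₁ (suc i) zero    = r₂ i zero
    q₁ (suc i) (suc j) = r₁ i j
    q₂ : ∀ i j → SameAtoms G H (g i) (lookup ρ j) (h′ i) (lookup σ j)
    q₂ zero    j = r₃ zero (suc j)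
    q₂ (suc i) j = r₂ i (suc j)

sim-trans : {A : Graph a} {B : Graph b} {C : Graph n} →
  ∀ d {ρ : Vec (Fin a) k} {σ τ} → Sim A B d ρ σ → Sim B C d σ τ → Sim A C d ρ τ
sim-trans {A = A} {B} {C} d = go d
  where
  match : ∀ {k} (ρ : Vec _ k) σ τ → Match A B ρ σ → Match B C σ τ → Match A C ρ τ
  match ρ σ τ p q i j = trans (proj₁ (p i j)) (proj₁ (q i j)) , trans (proj₂ (p i j)) (proj₂ (q i j))
  go : ∀ d {k} {ρ : Vec _ k} {σ τ} → Sim A B d ρ σ → Sim B C d σ τ → Sim A C d ρ τ
  go zero    {_} {ρ} {σ} {τ} s       t       = match ρ σ τ s t
  go (suc d) {_} {ρ} {σ} {τ} (p , s) (q , t) = match ρ σ τ p q , λ v →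
    let w , s′ = s v ; x , t′ = t w in x , go d s′ t′

-- Formulas and games

sim-literal : {G : Graph n} {H : Graph m} {φ : Formula k} → Literal φ →
  ∀ {ρ σ} → Match G H ρ σ → eval G φ ρ ≡ eval H φ σ
sim-literal (lit-eq x y)     s = proj₁ (s x y)
sim-literal (lit-adj x y)    s = proj₂ (s x y)
sim-literal (lit-negeq x y)  s = cong not (proj₁ (s x y))
sim-literal (lit-negadj x y) s = cong not (proj₂ (s x y))

module _ {G : Graph n} {H : Graph m} where

  sim-existential : ∀ {d} {φ : Formula k} → Existential φ → depth φ ≤ d →
    ∀ {ρ σ} → Sim G H d ρ σ → eval G φ ρ ≡ true → eval H φ σ ≡ true
  sim-existential {d = d} (e-lit l) _ s t = trans (sym (sim-literal l (sim⇒match d s))) t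
  sim-existential (e-and {φ = φ} {ψ} e f) p s t = let t₁ , t₂ = ∧-true⁻ t in
    ∧-true⁺ (sim-existential e (m⊔n≤o⇒m≤o (depth φ) _ p) s t₁)
            (sim-existential f (m⊔n≤o⇒n≤o (depth φ) _ p) s t₂)
  sim-existential (e-or {φ = φ} {ψ} e f) p s t with ∨-true⁻ t
  ... | inj₁ h = ∨-true⁺ˡ (sim-existential e (m⊔n≤o⇒m≤o (depth φ) _ p) s h)
  ... | inj₂ h = ∨-true⁺ʳ (sim-existential f (m⊔n≤o⇒n≤o (depth φ) _ p) s h)
  sim-existential {d = suc d} (e-ex e) p (_ , s) t =
    let v , q = any-tabulate⁻ _ id t ; w , s′ = s v
    in any-tabulate⁺ _ id w (sim-existential e (s≤s⁻¹ p) s′ q)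

  sim-universal : ∀ {d} {φ : Formula k} → Universal φ → depth φ ≤ d →
    ∀ {ρ σ} → Sim H G d σ ρ → eval G φ ρ ≡ true → eval H φ σ ≡ true
  sim-universal {d = d} (u-lit l) _ s t = trans (sim-literal l (sim⇒match d s)) t
  sim-universal (u-and {φ = φ} {ψ} e f) p s t = let t₁ , t₂ = ∧-true⁻ t in
    ∧-true⁺ (sim-universal e (m⊔n≤o⇒m≤o (depth φ) _ p) s t₁)
            (sim-universal f (m⊔n≤o⇒n≤o (depth φ) _ p) s t₂)
  sim-universal (u-or {φ = φ} {ψ} e f) p s t with ∨-true⁻ t
  ... | inj₁ h = ∨-true⁺ˡ (sim-universal e (m⊔n≤o⇒m≤o (depth φ) _ p) s h)
  ... | inj₂ h = ∨-true⁺ʳ (sim-universal f (m⊔n≤o⇒n≤o (depth φ) _ p) s h)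
  sim-universal {d = suc d} (u-all e) p (_ , s) t = all-tabulate⁺ _ id λ w →
    let v , s′ = s w in sim-universal e (s≤s⁻¹ p) s′ (all-tabulate⁻ _ id t v)

  -- A 0-alternating sentence is a positive combination of purely existential and purely universal
  -- sentences. The former transfer when Spoiler plays in `G`, the latter when he plays in `H`. A
  -- literal cannot occur, since a sentence has no free variables.
  ≼-zeroAlt : ∀ {d Φ} → ZeroAlt Φ → depth Φ ≤ suc d →
    G ≼[ d ] H → H ≼[ d ] G → G ⊨ Φ ≡ true → H ⊨ Φ ≡ true
  ≼-zeroAlt (z-lit (lit-eq () _))
  ≼-zeroAlt (z-lit (lit-adj () _))
  ≼-zeroAlt (z-lit (lit-negeq () _))
  ≼-zeroAlt (z-lit (lit-negadj () _))
  ≼-zeroAlt (z-and {φ = φ} e f) p s s′ t = let t₁ , t₂ = ∧-true⁻ t in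
    ∧-true⁺ (≼-zeroAlt e (m⊔n≤o⇒m≤o (depth φ) _ p) s s′ t₁)
            (≼-zeroAlt f (m⊔n≤o⇒n≤o (depth φ) _ p) s s′ t₂)
  ≼-zeroAlt (z-or {φ = φ} e f) p s s′ t with ∨-true⁻ t
  ... | inj₁ h = ∨-true⁺ˡ (≼-zeroAlt e (m⊔n≤o⇒m≤o (depth φ) _ p) s s′ h)
  ... | inj₂ h = ∨-true⁺ʳ (≼-zeroAlt f (m⊔n≤o⇒n≤o (depth φ) _ p) s s′ h)
  -- At the empty position matching is vacuous, so `≼[ d ]` is a `Sim` of `suc d` rounds.
  ≼-zeroAlt (z-all e) p s s′ t = sim-universal (u-all e) p ((λ ()) , s′) t
  ≼-zeroAlt (z-ex e)  p s s′ t = sim-existential (e-ex e) p ((λ ()) , s) t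

-- Hintikka formulas and the defining sentence.

-- The index set is non-empty because `Formula` has no constants for an empty conjunction or
-- disjunction.
⋀ ⋁ : (Fin (suc n) → Formula k) → Formula k
⋀ {zero}  f = f zero
⋀ {suc n} f = andᶠ (f zero) (⋀ (f ∘ suc))
⋁ {zero}  f = f zero
⋁ {suc n} f = orᶠ (f zero) (⋁ (f ∘ suc))

⋀-closed : (P : Formula k → Set) → (∀ {φ ψ} → P φ → P ψ → P (andᶠ φ ψ)) →
  (f : Fin (suc n) → Formula k) → (∀ i → P (f i)) → P (⋀ f)
⋀-closed {n = zero}  P c f p = p zero
⋀-closed {n = suc n} P c f p = c (p zero) (⋀-closed P c (f ∘ suc) (p ∘ suc))

⋁-closed : (P : Formula k → Set) → (∀ {φ ψ} → P φ → P ψ → P (orᶠ φ ψ)) →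
  (f : Fin (suc n) → Formula k) → (∀ i → P (f i)) → P (⋁ f)
⋁-closed {n = zero}  P c f p = p zero
⋁-closed {n = suc n} P c f p = c (p zero) (⋁-closed P c (f ∘ suc) (p ∘ suc))

module _ {H : Graph m} {σ : Vec (Fin m) k} where

  ⋀-true⁺ : (f : Fin (suc n) → Formula k) →
    (∀ i → eval H (f i) σ ≡ true) → eval H (⋀ f) σ ≡ true
  ⋀-true⁺ = ⋀-closed (λ φ → eval H φ σ ≡ true) ∧-true⁺

  ⋀-true⁻ : (f : Fin (suc n) → Formula k) →
    eval H (⋀ f) σ ≡ true → ∀ i → eval H (f i) σ ≡ true
  ⋀-true⁻ {zero}  f t zero    = t
  ⋀-true⁻ {suc n} f t zero    = proj₁ (∧-true⁻ t)
  ⋀-true⁻ {suc n} f t (suc i) = ⋀-true⁻ (f ∘ suc) (proj₂ (∧-true⁻ {eval H (f zero) σ} t)) i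

  ⋁-true⁺ : (f : Fin (suc n) → Formula k) →
    ∀ i → eval H (f i) σ ≡ true → eval H (⋁ f) σ ≡ true
  ⋁-true⁺ {zero}  f zero    t = t
  ⋁-true⁺ {suc n} f zero    t = ∨-true⁺ˡ t
  ⋁-true⁺ {suc n} f (suc i) t = ∨-true⁺ʳ {eval H (f zero) σ} (⋁-true⁺ (f ∘ suc) i t)

  ⋁-true⁻ : (f : Fin (suc n) → Formula k) →
    eval H (⋁ f) σ ≡ true → ∃ λ i → eval H (f i) σ ≡ true
  ⋁-true⁻ {zero}  f t = zero , t
  ⋁-true⁻ {suc n} f t with ∨-true⁻ {eval H (f zero) σ} t
  ... | inj₁ h = zero , h
  ... | inj₂ h = let i , r = ⋁-true⁻ (f ∘ suc) h in suc i , r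

signed : Bool → Formula k → Formula k
signed true  φ = φ
signed false φ = negᶠ φ

signed-true⁻ : ∀ {H : Graph m} b (φ : Formula k) {σ} →
  eval H (signed b φ) σ ≡ true → b ≡ eval H φ σ
signed-true⁻ true  φ t = sym t
signed-true⁻ {H = H} false φ {σ} t with eval H φ σ
... | false = refl

signed-true⁺ : ∀ {H : Graph m} b (φ : Formula k) {σ} →
  b ≡ eval H φ σ → eval H (signed b φ) σ ≡ true
signed-true⁺ true  φ t = sym t
signed-true⁺ false φ t = cong not (sym t)

module _ (G : Graph (suc n)) where

  diagramAt : Vec (Fin (suc n)) k → Fin k → Fin k → Formula k
  diagramAt ρ i j = andᶠ (signed ⌊ lookup ρ i ≟ lookup ρ j ⌋ (eqᶠ i j))
                         (signed (adj G (lookup ρ i) (lookup ρ j)) (adjᶠ i j))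

  diagram : Vec (Fin (suc n)) (suc k) → Formula (suc k)
  diagram ρ = ⋀ λ i → ⋀ λ j → diagramAt ρ i j

  -- Everything Spoiler can achieve in d rounds played in G, respectively the
  -- limits of what he can achieve in d rounds played in the other graph.
  type∃ type∀ : ℕ → Vec (Fin (suc n)) (suc k) → Formula (suc k)
  type∃ zero    ρ = diagram ρ
  type∃ (suc d) ρ = andᶠ (diagram ρ) (⋀ λ v → exᶠ (type∃ d (v ∷ ρ)))
  type∀ zero    ρ = diagram ρ
  type∀ (suc d) ρ = andᶠ (diagram ρ) (allᶠ (⋁ λ v → type∀ d (v ∷ ρ)))

  -- On a graph `H`, the existential half yields `G ≼[ d ] H` and the universal half `H ≼[ d ] G`.
  -- Keeping the halves in separate conjuncts avoids alternation.
  define : ℕ → Sentence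
  define d = andᶠ (⋀ λ v → exᶠ (type∃ d (v ∷ []))) (allᶠ (⋁ λ v → type∀ d (v ∷ [])))

  diagram-closed : (P : Formula (suc k) → Set) → (∀ {φ ψ} → P φ → P ψ → P (andᶠ φ ψ)) →
    (∀ {φ} → Literal φ → P φ) → ∀ ρ → P (diagram ρ)
  diagram-closed P c l ρ = ⋀-closed P c _ λ i →
    ⋀-closed P c (diagramAt ρ i) λ j → c (eq ⌊ lookup ρ i ≟ lookup ρ j ⌋)
                                         (ad (adj G (lookup ρ i) (lookup ρ j)))
    where
    eq : ∀ b {i j} → P (signed b (eqᶠ i j))
    eq true  = l (lit-eq _ _)
    eq false = l (lit-negeq _ _)
    ad : ∀ b {i j} → P (signed b (adjᶠ i j))
    ad true  = l (lit-adj _ _)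
    ad false = l (lit-negadj _ _)

  type∃-existential : ∀ d (ρ : Vec _ (suc k)) → Existential (type∃ d ρ)
  type∃-existential zero    ρ = diagram-closed Existential e-and e-lit ρ
  type∃-existential (suc d) ρ = e-and (diagram-closed Existential e-and e-lit ρ)
    (⋀-closed Existential e-and _ λ v → e-ex (type∃-existential d (v ∷ ρ)))

  type∀-universal : ∀ d (ρ : Vec _ (suc k)) → Universal (type∀ d ρ)
  type∀-universal zero    ρ = diagram-closed Universal u-and u-lit ρ
  type∀-universal (suc d) ρ = u-and (diagram-closed Universal u-and u-lit ρ)
    (u-all (⋁-closed Universal u-or _ λ v → type∀-universal d (v ∷ ρ)))

  define-zeroAlt : ∀ d → ZeroAlt (define d)
  define-zeroAlt d = z-and
    (⋀-closed ZeroAlt z-and _ λ v → z-ex (type∃-existential d (v ∷ [])))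
    (z-all (⋁-closed Universal u-or _ λ v → type∀-universal d (v ∷ [])))

  diagram-depth : ∀ {d} (ρ : Vec _ (suc k)) → depth (diagram ρ) ≤ d
  diagram-depth {d = d} = diagram-closed (λ φ → depth φ ≤ d) ⊔-lub λ
    { (lit-eq _ _) → z≤n ; (lit-adj _ _) → z≤n ; (lit-negeq _ _) → z≤n ; (lit-negadj _ _) → z≤n }

  type∃-depth : ∀ d (ρ : Vec _ (suc k)) → depth (type∃ d ρ) ≤ d
  type∃-depth zero    ρ = diagram-depth ρ
  type∃-depth (suc d) ρ = ⊔-lub (diagram-depth ρ)
    (⋀-closed (λ φ → depth φ ≤ suc d) ⊔-lub _ λ v → s≤s (type∃-depth d (v ∷ ρ)))

  type∀-depth : ∀ d (ρ : Vec _ (suc k)) → depth (type∀ d ρ) ≤ d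
  type∀-depth zero    ρ = diagram-depth ρ
  type∀-depth (suc d) ρ = ⊔-lub (diagram-depth ρ)
    (s≤s (⋁-closed (λ φ → depth φ ≤ d) ⊔-lub _ λ v → type∀-depth d (v ∷ ρ)))

  define-depth : ∀ d → depth (define d) ≤ suc d
  define-depth d = ⊔-lub
    (⋀-closed (λ φ → depth φ ≤ suc d) ⊔-lub _ λ v → s≤s (type∃-depth d (v ∷ [])))
    (s≤s (⋁-closed (λ φ → depth φ ≤ d) ⊔-lub _ λ v → type∀-depth d (v ∷ [])))

  diagram-true : (ρ : Vec _ (suc k)) → eval G (diagram ρ) ρ ≡ true
  diagram-true ρ = ⋀-true⁺ {H = G} {ρ} (λ i → ⋀ (diagramAt ρ i)) λ i →
    ⋀-true⁺ {H = G} {ρ} (diagramAt ρ i) λ j →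
    ∧-true⁺ (signed-true⁺ {H = G} _ (eqᶠ i j) {ρ} refl) (signed-true⁺ {H = G} _ (adjᶠ i j) {ρ} refl)

  type∃-true : ∀ d (ρ : Vec _ (suc k)) → eval G (type∃ d ρ) ρ ≡ true
  type∃-true zero    ρ = diagram-true ρ
  type∃-true (suc d) ρ = ∧-true⁺ (diagram-true ρ)
    (⋀-true⁺ {H = G} _ λ v → any-tabulate⁺ _ id v (type∃-true d (v ∷ ρ)))

  type∀-true : ∀ d (ρ : Vec _ (suc k)) → eval G (type∀ d ρ) ρ ≡ true
  type∀-true zero    ρ = diagram-true ρ
  type∀-true (suc d) ρ = ∧-true⁺ (diagram-true ρ)
    (all-tabulate⁺ _ id λ v → ⋁-true⁺ {H = G} _ v (type∀-true d (v ∷ ρ)))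

  define-true : ∀ d → G ⊨ define d ≡ true
  define-true d = ∧-true⁺
    (⋀-true⁺ {H = G} _ λ v → any-tabulate⁺ _ id v (type∃-true d (v ∷ [])))
    (all-tabulate⁺ _ id λ v → ⋁-true⁺ {H = G} _ v (type∀-true d (v ∷ [])))

  module _ (H : Graph (suc m)) where

    diagram⇒match : (ρ : Vec _ (suc k)) {σ : Vec _ (suc k)} →
      eval H (diagram ρ) σ ≡ true → Match G H ρ σ
    diagram⇒match ρ {σ} t i j =
      let t₁ , t₂ = ∧-true⁻ (⋀-true⁻ {H = H} {σ} (diagramAt ρ i) (⋀-true⁻ {H = H} {σ} _ t i) j)
      in signed-true⁻ {H = H} _ (eqᶠ i j) t₁ , signed-true⁻ {H = H} _ (adjᶠ i j) t₂

    diagram⇒match˘ : (ρ : Vec _ (suc k)) {σ : Vec _ (suc k)} →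
      eval H (diagram ρ) σ ≡ true → Match H G σ ρ
    diagram⇒match˘ ρ t i j = let p , q = diagram⇒match ρ t i j in sym p , sym q

    type∃⇒sim : ∀ d (ρ : Vec _ (suc k)) {σ : Vec _ (suc k)} →
      eval H (type∃ d ρ) σ ≡ true → Sim G H d ρ σ
    type∃⇒sim zero    ρ t = diagram⇒match ρ t
    type∃⇒sim (suc d) ρ {σ} t = let t₁ , t₂ = ∧-true⁻ t in diagram⇒match ρ t₁ , λ v →
      let w , q = any-tabulate⁻ _ id (⋀-true⁻ {H = H} {σ} (λ v → exᶠ (type∃ d (v ∷ ρ))) t₂ v)
      in w , type∃⇒sim d (v ∷ ρ) q

    type∀⇒sim : ∀ d (ρ : Vec _ (suc k)) {σ : Vec _ (suc k)} →
      eval H (type∀ d ρ) σ ≡ true → Sim H G d σ ρ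
    type∀⇒sim zero    ρ t = diagram⇒match˘ ρ t
    type∀⇒sim (suc d) ρ {σ} t = let t₁ , t₂ = ∧-true⁻ t in diagram⇒match˘ ρ t₁ , λ w →
      let v , q = ⋁-true⁻ {H = H} {w ∷ σ} (λ v → type∀ d (v ∷ ρ)) (all-tabulate⁻ _ id t₂ w)
      in v , type∀⇒sim d (v ∷ ρ) q

    define⇒≼ : ∀ d → H ⊨ define d ≡ true → G ≼[ d ] H × H ≼[ d ] G
    define⇒≼ d t = let t₁ , t₂ = ∧-true⁻ t in
      (λ v → let w , q = any-tabulate⁻ _ id (⋀-true⁻ {H = H} {[]} (λ v → exᶠ (type∃ d (v ∷ []))) t₁ v)
             in w , type∃⇒sim d (v ∷ []) q) ,
      (λ w → let v , q = ⋁-true⁻ {H = H} {w ∷ []} (λ v → type∀ d (v ∷ [])) (all-tabulate⁻ _ id t₂ w)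
             in v , type∀⇒sim d (v ∷ []) q)

  define-defines : ∀ d →
    (∀ m (H : Graph (suc m)) → G ≼[ d ] H → H ≼[ d ] G → Iso H G) → Defines (define d) G
  define-defines d iso = record
    { true-on-G = define-true d
    ; false-off = λ m H ¬iso → ¬-not λ t →
        let s , s′ = define⇒≼ H d t in ¬iso (iso m H s s′) }

-- The iterated logarithm

-- Recovers the private function behind log*: generalising the equation makes
-- unification solve for it.
mutual
  search : ℕ → ℕ → ℕ → ℕ
  search = _

  search-solution : ∀ n → (if suc n ≤ᵇ 1 then 0 else search (suc n) n 1) ≡ log* (suc n)
  search-solution n with n | suc n | 1
  ... | f | N | k = refl

n<2^n : ∀ n → n < 2 ^ n
n<2^n zero    = s≤s z≤n
n<2^n (suc n) = ≤-trans (+-mono-≤ (≤-trans (s≤s z≤n) (n<2^n n)) (n<2^n n))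
  (≤-reflexive (cong (2 ^ n +_) (sym (+-identityʳ (2 ^ n)))))

n<tower : ∀ n → n < tower n
n<tower zero    = s≤s z≤n
n<tower (suc n) = ≤-trans (s≤s (n<tower n)) (n<2^n (tower n))

tower-mono : ∀ {j k} → j ≤ k → tower j ≤ tower k
tower-mono {zero} {k} z≤n = ≤-trans (s≤s z≤n) (n<tower k)
tower-mono (s≤s p)        = ^-monoʳ-≤ 2 (tower-mono p)

-- The invariant `n ≤ f + k` makes running out of fuel harmless: then `n ≤ k < tower k`.
search-sound : ∀ n f k → n ≤ f + k → n ≤ tower (search n f k)
search-sound n zero    k p = ≤-trans p (<⇒≤ (n<tower k))
search-sound n (suc f) k p with n ≤ᵇ tower k in eq
... | true  = ≤ᵇ⇒≤ n (tower k) (subst T (sym eq) _)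
... | false = search-sound n f (suc k) (≤-trans p (≤-reflexive (sym (+-suc f k))))

search-least : ∀ n f k j → k ≤ j → n ≤ tower j → search n f k ≤ j
search-least n zero    k j k≤j p = k≤j
search-least n (suc f) k j k≤j p with n ≤ᵇ tower k in eq
... | true  = k≤j
... | false = search-least n f (suc k) j
  (≤∧≢⇒< k≤j λ { refl → subst T eq (≤⇒≤ᵇ p) }) p

≤tower-log* : ∀ n → n ≤ tower (log* n)
≤tower-log* n = search-sound n n 0 (≤-reflexive (sym (+-identityʳ n)))

log*-least : ∀ {n j} → n ≤ tower j → log* n ≤ j
log*-least {n} {j} = search-least n n 0 j z≤n

tower<⇐<log* : ∀ {n j} → j < log* n → tower j < n
tower<⇐<log* j< = ≰⇒> λ n≤ → <⇒≱ j< (log*-least n≤)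

-- Counting game types

-- An ordered pair of pebbles carries an equality bit and an adjacency bit, hence the `4`. With
-- rounds left, a type is a set of types with one more pebble, hence the exponential.
typeCount : ℕ → ℕ → ℕ
typeCount k zero    = (4 ^ k) ^ k
typeCount k (suc d) = 2 ^ typeCount (suc k) d

bit : Bool → Fin 2
bit false = zero
bit true  = suc zero

bit-injective : ∀ {x y} → bit x ≡ bit y → x ≡ y
bit-injective {false} {false} _ = refl
bit-injective {true}  {true}  _ = refl

funToFin-injective : {f g : Fin m → Fin n} → funToFin f ≡ funToFin g → ∀ i → f i ≡ g i
funToFin-injective {f = f} {g} p i = trans (sym (finToFun-funToFin f i))
  (trans (cong (λ c → finToFun c i) p) (finToFun-funToFin g i))

module _ (G : Graph (suc n)) where

  gameType : (d : ℕ) → Vec (Fin (suc n)) k → Fin (typeCount k d)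
  gameType zero ρ = funToFin λ i → funToFin λ j →
    combine (bit ⌊ lookup ρ i ≟ lookup ρ j ⌋) (bit (adj G (lookup ρ i) (lookup ρ j)))
  gameType (suc d) ρ = funToFin λ t → bit ⌊ any? (λ v → gameType d (v ∷ ρ) ≟ t) ⌋

  gameType⇒sim : ∀ d {ρ σ : Vec (Fin (suc n)) k} → gameType d ρ ≡ gameType d σ → Sim G G d ρ σ
  gameType⇒sim zero p i j =
    let q , r = combine-injective _ _ _ _ (funToFin-injective (funToFin-injective p i) j)
    in bit-injective q , bit-injective r
  -- A type with rounds left records no atoms. They are read off from the extension by vertex
  -- `zero`, available since the graph is non-empty.
  gameType⇒sim (suc d) {ρ} {σ} p = (λ i j → sim⇒match d (proj₂ (ext zero)) (suc i) (suc j)) , ext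
    where
    ext : ∀ v → ∃ λ w → Sim G G d (v ∷ ρ) (w ∷ σ)
    ext v =
      let t = gameType d (v ∷ ρ)
          in-σ = ⌊⌋-true (any? λ w → gameType d (w ∷ σ) ≟ t)
            (trans (sym (bit-injective (funToFin-injective p t)))
                   (⌊⌋-yes (any? λ w → gameType d (w ∷ ρ) ≟ t) (v , refl)))
      in proj₁ in-σ , gameType⇒sim d (sym (proj₂ in-σ))

  -- A set of vertices meeting every continuation type of every position
  -- reachable within it.
  witnesses : (d : ℕ) → Vec (Fin (suc n)) k → List (Fin (suc n))
  witnessesFor : (d : ℕ) (ρ : Vec (Fin (suc n)) k) {t : Fin (typeCount (suc k) d)} →
    Dec (∃ λ v → gameType d (v ∷ ρ) ≡ t) → List (Fin (suc n))
  witnesses zero    ρ = []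
  witnesses (suc d) ρ =
    concat (tabulate λ t → witnessesFor d ρ (any? λ v → gameType d (v ∷ ρ) ≟ t))
  witnessesFor d ρ (yes (v , _)) = v ∷ witnesses d (v ∷ ρ)
  witnessesFor d ρ (no _)        = []

  -- The source of safe replies for Duplicator: the vertex chosen for the type of `v` is itself a
  -- witness, and so is everything chosen beneath it.
  representative : ∀ d (ρ : Vec (Fin (suc n)) k) v → ∃ λ v′ →
    gameType d (v ∷ ρ) ≡ gameType d (v′ ∷ ρ) × v′ ∈ witnesses (suc d) ρ ×
    (∀ {z} → z ∈ witnesses d (v′ ∷ ρ) → z ∈ witnesses (suc d) ρ)
  representative d ρ v = find (any? λ u → gameType d (u ∷ ρ) ≟ gameType d (v ∷ ρ)) member
    where
    member : ∀ {z} → z ∈ witnessesFor d ρ (any? λ u → gameType d (u ∷ ρ) ≟ gameType d (v ∷ ρ)) →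
      z ∈ witnesses (suc d) ρ
    member z∈ = ∈-concat⁺′ z∈ (∈-tabulate⁺ (gameType d (v ∷ ρ)))
    find : (c : Dec (∃ λ u → gameType d (u ∷ ρ) ≡ gameType d (v ∷ ρ))) →
      (∀ {z} → z ∈ witnessesFor d ρ c → z ∈ witnesses (suc d) ρ) → ∃ λ v′ →
      gameType d (v ∷ ρ) ≡ gameType d (v′ ∷ ρ) × v′ ∈ witnesses (suc d) ρ ×
      (∀ {z} → z ∈ witnesses d (v′ ∷ ρ) → z ∈ witnesses (suc d) ρ)
    find (yes (v′ , p)) mem = v′ , sym p , mem (here refl) , (λ z∈ → mem (there z∈))
    find (no ¬p)        mem = contradiction (v , refl) ¬p

witnessCount : ℕ → ℕ → ℕ
witnessCount k zero    = 0
witnessCount k (suc d) = typeCount (suc k) d * suc (witnessCount (suc k) d)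

length-concat-tabulate : ∀ {A : Set} c (f : Fin n → List A) → (∀ i → length (f i) ≤ c) →
  length (concat (tabulate f)) ≤ n * c
length-concat-tabulate {zero}  c f p = z≤n
length-concat-tabulate {suc n} c f p = ≤-trans
  (≤-reflexive (length-++ (f zero)))
  (+-mono-≤ (p zero) (length-concat-tabulate c (f ∘ suc) (p ∘ suc)))

length-witnesses : (G : Graph (suc n)) → ∀ d (ρ : Vec (Fin (suc n)) k) →
  length (witnesses G d ρ) ≤ witnessCount k d
length-witnesses G zero    ρ = z≤n
length-witnesses {k = k} G (suc d) ρ = length-concat-tabulate _ _ λ t →
  bound (any? λ v → gameType G d (v ∷ ρ) ≟ t)
  where
  bound : ∀ {t} (c : Dec (∃ λ v → gameType G d (v ∷ ρ) ≡ t)) →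
    length (witnessesFor G d ρ c) ≤ suc (witnessCount (suc k) d)
  bound (yes (v , _)) = s≤s (length-witnesses G d (v ∷ ρ))
  bound (no _)        = z≤n

missing : (xs : List (Fin n)) → length xs < n → ∃ λ z → z ∉ xs
missing {n} xs p = ¬∀⟶∃¬ n (_∈ xs) (λ z → z ∈? xs) λ all∈ →
  let i , j , i<j , e = pigeonhole p (index ∘ all∈)
  in <⇒≢ i<j (trans (lookup-index (all∈ i))
       (trans (cong (List.lookup xs) e) (sym (lookup-index (all∈ j)))))
  where open import Data.List.Membership.DecPropositional (_≟_ {n = n}) using (_∈?_)

-- Deleting a vertex that is not a witness.

_─_ : Graph (suc n) → Fin (suc n) → Graph n
G ─ z = record
  { adj    = λ u v → adj G (punchIn z u) (punchIn z v)
  ; sym    = λ u v → Graph.sym G (punchIn z u) (punchIn z v)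
  ; irrefl = λ u → irrefl G (punchIn z u)
  }

module _ (G : Graph (suc n)) (z : Fin (suc n)) where

  same-punchIn : ∀ u v → SameAtoms G (G ─ z) (punchIn z u) (punchIn z v) u v
  same-punchIn u v = eq , refl
    where
    eq : ⌊ punchIn z u ≟ punchIn z v ⌋ ≡ ⌊ u ≟ v ⌋
    eq with u ≟ v
    ... | yes refl = ≟-refl (punchIn z u)
    ... | no u≢v with punchIn z u ≟ punchIn z v
    ...   | yes p = contradiction (punchIn-injective z u v p) u≢v
    ...   | no _  = refl

  match-delete : {ρ : Vec (Fin (suc n)) k} {σ : Vec (Fin n) k} →
    (∀ i → lookup ρ i ≡ punchIn z (lookup σ i)) → Match G (G ─ z) ρ σ
  match-delete {σ = σ} e i j rewrite e i | e j = same-punchIn (lookup σ i) (lookup σ j)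

  delete-match : {ρ : Vec (Fin (suc n)) k} {σ : Vec (Fin n) k} →
    (∀ i → lookup ρ i ≡ punchIn z (lookup σ i)) → Match (G ─ z) G σ ρ
  delete-match {ρ = ρ} {σ} e i j = let p , q = match-delete {ρ = ρ} {σ} e i j in sym p , sym q

  delete-sim : ∀ d {ρ : Vec (Fin (suc n)) k} {σ : Vec (Fin n) k} →
    (∀ i → lookup ρ i ≡ punchIn z (lookup σ i)) → Sim (G ─ z) G d σ ρ
  delete-sim zero    {ρ} {σ} e = delete-match {ρ = ρ} {σ} e
  delete-sim (suc d) {ρ} {σ} e = delete-match {ρ = ρ} {σ} e ,
    λ v → punchIn z v , delete-sim d (λ { zero → refl ; (suc i) → e i })

  -- Duplicator trades Spoiler's `v` for the representative `v′` of its type, which differs from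
  -- `z`, and copies `v′`. Play then continues from the position with `v′` in place of `v`, where
  -- `z` is again no witness.
  sim-delete : ∀ d {ρ : Vec (Fin (suc n)) k} {σ : Vec (Fin n) k} → z ∉ witnesses G d ρ →
    (∀ i → lookup ρ i ≡ punchIn z (lookup σ i)) → Sim G (G ─ z) d ρ σ
  sim-delete zero    {ρ} {σ} z∉ e = match-delete {ρ = ρ} {σ} e
  sim-delete (suc d) {ρ} {σ} z∉ e = match-delete {ρ = ρ} {σ} e , λ v →
    let v′ , same , v′∈ , ⊆ = representative G d ρ v
        z≢v′ = λ z≡v′ → z∉ (subst (_∈ witnesses G (suc d) ρ) (sym z≡v′) v′∈)
    in punchOut z≢v′ , sim-trans d (gameType⇒sim G d same)
         (sim-delete d (λ z∈ → z∉ (⊆ z∈))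
           (λ { zero → sym (punchIn-punchOut z≢v′) ; (suc i) → e i }))

iso⇒size≤ : {H : Graph m} {G : Graph n} → Iso H G → n ≤ m
iso⇒size≤ iso = ≮⇒≥ λ m<n →
  let i , j , i<j , e = pigeonhole m<n (from iso)
  in <⇒≢ i<j (trans (sym (to∘from iso i)) (trans (cong (to iso) e) (to∘from iso j)))

-- In a larger graph some vertex is no witness, and deleting it keeps `Φ` true. Two vertices at
-- least are assumed so that the smaller graph is non-empty, as `Defines` requires.
defined⇒size≤ : ∀ {d Φ} (G : Graph (suc (suc n))) → ZeroAlt Φ → depth Φ ≤ suc d → Defines Φ G →
  suc (suc n) ≤ witnessCount 0 (suc d)
defined⇒size≤ {n} {d} {Φ} G za dp def = ≮⇒≥ λ small →
  let z , z∉ = missing (witnesses G (suc d) []) (≤-<-trans (length-witnesses G (suc d) []) small)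
      H⊨Φ = ≼-zeroAlt {G = G} {G ─ z} za dp
        (proj₂ (sim-delete G z (suc d) {[]} {[]} z∉ λ ()))
        (proj₂ (delete-sim G z (suc d) {[]} {[]} λ ()))
        (Defines.true-on-G def)
  in contradiction
       (trans (sym H⊨Φ) (Defines.false-off def n (G ─ z) λ iso → 1+n≰n (iso⇒size≤ iso)))
       λ ()

-- Tower estimates and the lower bound.

2^+2^ : ∀ a → 2 ^ a + 2 ^ a ≡ 2 ^ suc a
2^+2^ a = cong (2 ^ a +_) (sym (+-identityʳ (2 ^ a)))

double<2^ : ∀ t → 3 ≤ t → t + t < 2 ^ t
double<2^ (suc (suc (suc zero))) _ = s≤s (s≤s (s≤s (s≤s (s≤s (s≤s (s≤s z≤n))))))
double<2^ 1 (s≤s ())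
double<2^ 2 (s≤s (s≤s ()))
double<2^ (suc t@(suc (suc (suc _)))) (s≤s p) = begin-strict
  suc t + suc t   ≡⟨ cong suc (+-suc t t) ⟩
  2 + (t + t)     <⟨ +-mono-≤-< (^-monoʳ-≤ 2 {1} {t} (s≤s z≤n)) (double<2^ t (s≤s (s≤s (s≤s z≤n)))) ⟩
  2 ^ t + 2 ^ t   ≡⟨ 2^+2^ t ⟩
  2 ^ suc t       ∎
  where open ≤-Reasoning

square≤2^ : ∀ e → e * e ≤ 2 ^ suc e
square≤2^ zero    = z≤n
square≤2^ (suc e) = begin
  suc e * suc e             ≡⟨ cong (suc e +_) (*-suc e e) ⟩
  suc e + (e + e * e)       ≡⟨ sym (+-assoc (suc e) e (e * e)) ⟩
  (suc e + e) + e * e       ≤⟨ +-mono-≤ (+-mono-≤ (n<2^n e) (<⇒≤ (n<2^n e))) (square≤2^ e) ⟩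
  (2 ^ e + 2 ^ e) + 2 ^ suc e ≡⟨ cong (_+ 2 ^ suc e) (2^+2^ e) ⟩
  2 ^ suc e + 2 ^ suc e     ≡⟨ 2^+2^ (suc e) ⟩
  2 ^ suc (suc e)           ∎
  where open ≤-Reasoning

4≤typeCount : ∀ k d → 4 ≤ typeCount (suc k) d
4≤typeCount k zero = begin
  4                    ≤⟨ ^-monoʳ-≤ 4 {1} {suc k} (s≤s z≤n) ⟩
  4 ^ suc k            ≡⟨ sym (*-identityʳ _) ⟩
  (4 ^ suc k) ^ 1      ≤⟨ ^-monoʳ-≤ (4 ^ suc k) {{m^n≢0 4 (suc k)}} {1} {suc k} (s≤s z≤n) ⟩
  (4 ^ suc k) ^ suc k  ∎
  where open ≤-Reasoning
4≤typeCount k (suc d) = ≤-trans (4≤typeCount (suc k) d) (<⇒≤ (n<2^n _))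

-- Another round at most squares a type count `2 ^ t` on the left but exponentiates it on the right:
-- the product is at most `2 ^ (t + t)`, and `t + t < 2 ^ t` once `t` is at least 3.
witnessCount<typeCount : ∀ k d → witnessCount k d < typeCount k d
witnessCount<typeCount k zero = m^n>0 (4 ^ k) {{m^n≢0 4 k}} k
witnessCount<typeCount k (suc zero) =
  subst (_< 2 ^ typeCount (suc k) 0) (sym (*-identityʳ _)) (n<2^n (typeCount (suc k) 0))
witnessCount<typeCount k (suc d@(suc d′)) = begin-strict
  typeCount (suc k) d * suc (witnessCount (suc k) d)
    ≤⟨ *-monoʳ-≤ (typeCount (suc k) d) (witnessCount<typeCount (suc k) d) ⟩
  2 ^ t * 2 ^ t
    ≡⟨ sym (^-distribˡ-+-* 2 t t) ⟩
  2 ^ (t + t)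
    <⟨ ^-monoʳ-< 2 (s≤s (s≤s z≤n)) (double<2^ t (≤-trans (s≤s (s≤s (s≤s z≤n))) (4≤typeCount (suc k) d′))) ⟩
  2 ^ (2 ^ t) ∎
  where
  open ≤-Reasoning
  t = typeCount (suc (suc k)) d′

-- Bounding the square makes the induction close: squaring `2 ^ t` doubles `t`, and `t + t ≤ t * t`.
-- The sum `d + suc k` is the number of pebbles at the end of the game, and `X` is the count of
-- atomic types for that many.
typeCount²≤tower : ∀ d k c → let X = (4 ^ (d + suc k)) ^ (d + suc k) in
  X * X ≤ tower c → typeCount (suc k) d * typeCount (suc k) d ≤ tower (d + c)
typeCount²≤tower zero    k c p = p
typeCount²≤tower (suc d) k c p = begin
  2 ^ t * 2 ^ t    ≡⟨ sym (^-distribˡ-+-* 2 t t) ⟩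
  2 ^ (t + t)      ≤⟨ ^-monoʳ-≤ 2 (≤-trans (≤-reflexive (cong (t +_) (sym (+-identityʳ t))))
                        (*-monoˡ-≤ t (≤-trans (s≤s (s≤s z≤n)) (4≤typeCount (suc k) d)))) ⟩
  2 ^ (t * t)      ≤⟨ ^-monoʳ-≤ 2 (typeCount²≤tower d (suc k) c
                        (subst (λ e → (4 ^ e) ^ e * (4 ^ e) ^ e ≤ tower c) (sym (+-suc d (suc k))) p)) ⟩
  2 ^ tower (d + c) ∎
  where
  open ≤-Reasoning
  t = typeCount (suc (suc k)) d

square-4^²≤ : ∀ e M → e + 3 ≤ M → (4 ^ e) ^ e * (4 ^ e) ^ e ≤ 2 ^ (2 ^ M)
square-4^²≤ e M p = begin
  (4 ^ e) ^ e * (4 ^ e) ^ e    ≡⟨ cong₂ _*_ X≡ X≡ ⟩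
  2 ^ (2 * (e * e)) * 2 ^ (2 * (e * e)) ≡⟨ sym (^-distribˡ-+-* 2 (2 * (e * e)) (2 * (e * e))) ⟩
  2 ^ (2 * (e * e) + 2 * (e * e)) ≤⟨ ^-monoʳ-≤ 2 exponent≤ ⟩
  2 ^ (2 ^ M) ∎
  where
  open ≤-Reasoning
  X≡ : (4 ^ e) ^ e ≡ 2 ^ (2 * (e * e))
  X≡ = trans (^-*-assoc 4 e e) (^-*-assoc 2 2 (e * e))
  exponent≤ : 2 * (e * e) + 2 * (e * e) ≤ 2 ^ M
  exponent≤ = begin
    2 * (e * e) + 2 * (e * e)  ≤⟨ +-mono-≤ (*-monoʳ-≤ 2 (square≤2^ e)) (*-monoʳ-≤ 2 (square≤2^ e)) ⟩
    2 ^ (2 + e) + 2 ^ (2 + e)  ≡⟨ 2^+2^ (2 + e) ⟩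
    2 ^ (3 + e)                ≤⟨ ^-monoʳ-≤ 2 (≤-trans (≤-reflexive (+-comm 3 e)) p) ⟩
    2 ^ M                      ∎

zeroAlt-depth : ∀ {Φ : Sentence} → ZeroAlt Φ → 1 ≤ depth Φ
zeroAlt-depth (z-lit (lit-eq () _))
zeroAlt-depth (z-lit (lit-adj () _))
zeroAlt-depth (z-lit (lit-negeq () _))
zeroAlt-depth (z-lit (lit-negadj () _))
zeroAlt-depth (z-and {φ = φ} {ψ} e f) = ≤-trans (zeroAlt-depth e) (m≤m⊔n (depth φ) (depth ψ))
zeroAlt-depth (z-or {φ = φ} {ψ} e f)  = ≤-trans (zeroAlt-depth e) (m≤m⊔n (depth φ) (depth ψ))
zeroAlt-depth (z-all _) = s≤s z≤n
zeroAlt-depth (z-ex _)  = s≤s z≤n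

-- This is where the iterated `log*` arises. The atomic types of the final `d + 1` pebbles cost two
-- exponentials over `d + 4`, which is at most `L`, hence at most `tower (log* L)`; the `d`
-- remaining levels add one exponential each.
witnessCount≤tower : ∀ d L → suc d + 2 + log* L ≤ L → witnessCount 0 (suc d) ≤ tower (d + (2 + log* L))
witnessCount≤tower d L p = begin
  typeCount 1 d * suc (witnessCount 1 d) ≤⟨ *-monoʳ-≤ (typeCount 1 d) (witnessCount<typeCount 1 d) ⟩
  typeCount 1 d * typeCount 1 d          ≤⟨ typeCount²≤tower d 0 (2 + log* L)
                                              (square-4^²≤ (d + 1) (tower (log* L)) e+3≤) ⟩
  tower (d + (2 + log* L))               ∎
  where
  open ≤-Reasoning
  -- The hypothesis reads `d + 3 + log* L ≤ L`; positivity of `log* L` turns it into `d + 4 ≤ L`.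
  1≤log*L : 1 ≤ log* L
  1≤log*L = ≰⇒> λ log≤0 → contradiction
    (begin
      2                    ≤⟨ m≤n+m 2 (suc d) ⟩
      suc d + 2            ≤⟨ m≤m+n (suc d + 2) (log* L) ⟩
      suc d + 2 + log* L   ≤⟨ p ⟩
      L                    ≤⟨ ≤tower-log* L ⟩
      tower (log* L)       ≤⟨ tower-mono log≤0 ⟩
      1                    ∎)
    λ { (s≤s ()) }
  e+3≤ : d + 1 + 3 ≤ tower (log* L)
  e+3≤ = begin
    d + 1 + 3            ≡⟨ cong (_+ 3) (+-comm d 1) ⟩
    suc d + 3            ≡⟨ sym (+-assoc (suc d) 2 1) ⟩
    suc d + 2 + 1        ≤⟨ +-monoʳ-≤ (suc d + 2) 1≤log*L ⟩
    suc d + 2 + log* L   ≤⟨ p ⟩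
    L                    ≤⟨ ≤tower-log* L ⟩
    tower (log* L)       ∎

lower-bound : ∀ n (G : Graph (suc n)) (Φ : Sentence) → ZeroAlt Φ → Defines Φ G →
  log* (suc n) ≤ depth Φ + log* (log* (suc n)) + 1
-- A single vertex cannot be deleted, but here `log* 1` computes to `0`.
lower-bound zero    G Φ za def = z≤n
lower-bound (suc n) G Φ za def = ≮⇒≥ λ big → go (depth Φ) refl (zeroAlt-depth za) big
  where
  open ≤-Reasoning
  L = log* (suc (suc n))
  go : ∀ D → depth Φ ≡ D → 1 ≤ D → ¬ (depth Φ + log* L + 1 < L)
  go (suc d) D≡ _ big = n≮n (suc (suc n)) (begin-strict
    suc (suc n)               ≤⟨ defined⇒size≤ G za (≤-reflexive D≡) def ⟩
    witnessCount 0 (suc d)    ≤⟨ witnessCount≤tower d L (≤-trans (≤-reflexive (cong suc (trans (+-assoc d 2 _) eq))) big′) ⟩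
    tower (d + (2 + log* L))  <⟨ tower<⇐<log* (≤-trans (≤-reflexive (cong suc eq)) big′) ⟩
    suc (suc n)               ∎)
    where
    big′ : suc d + log* L + 1 < L
    big′ = subst (λ D → D + log* L + 1 < L) D≡ big
    eq : d + (2 + log* L) ≡ suc d + log* L + 1
    eq = trans (+-suc d (suc (log* L)))
      (cong suc (trans (+-suc d (log* L)) (+-comm 1 (d + log* L))))

-- Graphs with named vertices

Named : Graph n → ℕ → Fin n → Set
Named G d v = ∀ w → Sim G G d (v ∷ []) (w ∷ []) → v ≡ w

-- Spoiler spends one move on `u`, which only `u` itself can answer; so `v` and `w` must relate to
-- `u` in the same way.
named⇒same : {G : Graph n} → ∀ d {u v w} → Named G d u →
  Sim G G (suc d) (v ∷ []) (w ∷ []) → SameAtoms G G u v u w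
named⇒same d {u} named (_ , s) with s u
... | u′ , t with refl ← named u′ (sim-head d t) = sim⇒match d t zero (suc zero)

-- Duplicator's replies u ↦ x u in H and y ↦ f y in G are mutually inverse:
-- if Spoiler plays y and then x u, the second reply must be u.
named⇒iso : (G : Graph n) (H : Graph m) → ∀ d → (∀ v → Named G d v) →
  G ≼[ suc d ] H → H ≼[ suc d ] G → Iso H G
named⇒iso {n} {m} G H d named s t = record
  { to      = f
  ; from    = x
  ; from∘to = λ y → same-≡⇐ {G = H} {G} (key (f y) y) refl
  ; to∘from = λ u → sym (same-≡⇒ {G = H} {G} (key u (x u)) refl)
  ; pres    = λ y z → trans (cong (λ w → adj H w z) (sym (same-≡⇐ {G = H} {G} (key (f y) y) refl)))
                            (proj₂ (key (f y) z))
  }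
  where
  x : Fin n → Fin m
  x u = proj₁ (s u)
  f : Fin m → Fin n
  f y = proj₁ (t y)
  key : ∀ u y → SameAtoms H G (x u) y u (f y)
  key u y with proj₂ (proj₂ (t y)) (x u)
  ... | u′ , r with named u u′ (sim-trans d (sim-weaken d (proj₂ (s u))) (sim-head d r))
  ...   | refl = sim⇒match d r zero (suc zero)

-- Spoiler exhibits all of G, and one vertex too many in a larger H.
size-rounds⇒iso : (G : Graph (suc n)) (H : Graph m) →
  G ≼[ suc n ] H → H ≼[ suc n ] G → Iso H G
size-rounds⇒iso {n} {m} G H s t = record
  { to      = λ y → proj₁ (covered y)
  ; from    = h
  ; from∘to = λ y → proj₂ (covered y)
  ; to∘from = λ i → same-≡⇐ {G = G} {H} (h-same _ i) (proj₂ (covered (h i)))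
  ; pres    = λ y z → trans (sym (cong₂ (adj H) (proj₂ (covered y)) (proj₂ (covered z))))
                            (sym (proj₂ (h-same (proj₁ (covered y)) (proj₁ (covered z)))))
  }
  where
  -- Of the `2 + n` moves the first goes to `zero`, to enter `Sim`; the other `1 + n` list all of
  -- `G`.
  G-play = play {G = G} {H} (suc n) id (proj₂ (s zero))
  h : Fin (suc n) → Fin m
  h = proj₁ G-play
  h-same : ∀ i j → SameAtoms G H i j (h i) (h j)
  h-same = proj₁ (proj₂ G-play)
  covered : ∀ y → ∃ λ i → h i ≡ y
  covered y with any? (λ i → h i ≟ y)
  ... | yes p = p
  ... | no ¬p = contradiction (pigeonhole (n<1+n (suc n)) reply) no-collision
    where
    H-play = play {G = H} {G} (suc n) h (proj₂ (t y))
    reply : Fin (suc (suc n)) → Fin (suc n)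
    reply zero    = proj₁ (t y)
    reply (suc i) = proj₁ H-play i
    no-collision : ¬ ∃ λ i → ∃ λ j → i Fin.< j × reply i ≡ reply j
    no-collision (zero , suc j , _ , e) =
      ¬p (j , same-≡⇐ {G = H} {G} (proj₁ (proj₂ (proj₂ H-play)) j zero) (sym e))
    no-collision (suc i , suc j , i<j , e) = <⇒≢ (s≤s⁻¹ i<j)
      (same-≡⇐ {G = G} {H} (h-same i j) (same-≡⇐ {G = H} {G} (proj₁ (proj₂ H-play) i j) e))

-- Binary digits.

odd : ℕ → Bool
odd zero          = false
odd (suc zero)    = true
odd (suc (suc n)) = odd n

odd-suc : ∀ n → odd (suc n) ≡ not (odd n)
odd-suc zero          = refl
odd-suc (suc zero)    = refl
odd-suc (suc (suc n)) = odd-suc n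

odd-half-injective : ∀ a b → odd a ≡ odd b → ⌊ a /2⌋ ≡ ⌊ b /2⌋ → a ≡ b
odd-half-injective zero          zero          _ _ = refl
odd-half-injective zero          (suc zero)    () _
odd-half-injective zero          (suc (suc _)) _ ()
odd-half-injective (suc zero)    (suc zero)    _ _ = refl
odd-half-injective (suc (suc a)) (suc (suc b)) p q =
  cong (2 +_) (odd-half-injective a b p (ℕ.suc-injective q))

half< : ∀ a m → a < m + m → ⌊ a /2⌋ < m
half< zero          (suc m) p = s≤s z≤n
half< (suc zero)    (suc m) p = s≤s z≤n
half< (suc (suc a)) (suc m) p =
  s≤s (half< a m (s≤s⁻¹ (≤-trans (s≤s⁻¹ p) (≤-reflexive (+-suc m m)))))

digit : ℕ → ℕ → Bool
digit zero    a = odd a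
digit (suc j) a = digit j ⌊ a /2⌋

digit-zero : ∀ j → digit j 0 ≡ false
digit-zero zero    = refl
digit-zero (suc j) = digit-zero j

digits-injective : ∀ ℓ {a b} → a < 2 ^ ℓ → b < 2 ^ ℓ →
  (∀ {j} → j < ℓ → digit j a ≡ digit j b) → a ≡ b
digits-injective zero    (s≤s z≤n) (s≤s z≤n) _ = refl
digits-injective (suc ℓ) {a} {b} p q e = odd-half-injective a b (e (s≤s z≤n))
  (digits-injective ℓ (half< a (2 ^ ℓ) (≤-trans p (≤-reflexive (sym (2^+2^ ℓ)))))
                      (half< b (2 ^ ℓ) (≤-trans q (≤-reflexive (sym (2^+2^ ℓ)))))
                      (λ j<ℓ → e (s≤s j<ℓ)))

-- Sizes and numbering of the layers.

width : ℕ → ℕ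
width zero    = 2
width (suc i) = pred (2 ^ width i)

offset : ℕ → ℕ
offset zero    = 0
offset (suc i) = offset i + width i

-- Strictness pays for the `pred`: `2 ^ width i` is at least twice `2 ^ tower i`, so it still
-- exceeds `2 ^ tower i` after losing one.
tower<width : ∀ i → tower i < width i
tower<width zero    = s≤s (s≤s z≤n)
tower<width (suc i) = suc[m]≤n⇒m≤pred[n] (begin
  2 + 2 ^ tower i              ≤⟨ +-monoˡ-≤ (2 ^ tower i) (^-monoʳ-≤ 2 {1} (tower-mono {0} {i} z≤n)) ⟩
  2 ^ tower i + 2 ^ tower i    ≡⟨ 2^+2^ (tower i) ⟩
  2 ^ suc (tower i)            ≤⟨ ^-monoʳ-≤ 2 (tower<width i) ⟩
  2 ^ width i                  ∎)
  where open ≤-Reasoning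

0<width : ∀ i → 0 < width i
0<width i = ≤-trans (s≤s z≤n) (tower<width i)

offset-mono : ∀ {i j} → i ≤ j → offset i ≤ offset j
offset-mono {j = zero}  z≤n = z≤n
offset-mono {j = suc j} p with m≤n⇒m<n∨m≡n p
... | inj₁ i<1+j = ≤-trans (offset-mono (s≤s⁻¹ i<1+j)) (m≤m+n (offset j) (width j))
... | inj₂ refl  = ≤-refl

next : ℕ × ℕ → ℕ × ℕ
next (i , c) with suc c <? width i
... | yes _ = i , suc c
... | no  _ = suc i , 0

-- Layer and index within the layer, when the layers are laid out consecutively.
position : ℕ → ℕ × ℕ
position zero    = 0 , 0
position (suc v) = next (position v)

IsPosition : ℕ → ℕ × ℕ → Set
IsPosition v (i , c) = c < width i × offset i + c ≡ v

next-isPosition : ∀ v p → IsPosition v p → IsPosition (suc v) (next p)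
next-isPosition v (i , c) (c<w , refl) with suc c <? width i
... | yes 1+c<w = 1+c<w , +-suc (offset i) c
... | no  1+c≮w = 0<width (suc i) ,
  trans (+-identityʳ _) (trans (cong (offset i +_) (≤-antisym (≮⇒≥ 1+c≮w) c<w)) (+-suc (offset i) c))

isPosition : ∀ v → IsPosition v (position v)
isPosition zero    = s≤s z≤n , refl
isPosition (suc v) = next-isPosition v (position v) (isPosition v)

position-≮ : ∀ {v i c i′ c′} → IsPosition v (i , c) → IsPosition v (i′ , c′) → ¬ i < i′
position-≮ {i = i} {c} {i′} {c′} (c<w , refl) (_ , e) i<i′ = <-irrefl refl (begin-strict
  offset i + c       <⟨ +-monoʳ-< (offset i) c<w ⟩
  offset (suc i)     ≤⟨ offset-mono i<i′ ⟩
  offset i′          ≤⟨ m≤m+n (offset i′) c′ ⟩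
  offset i′ + c′     ≡⟨ e ⟩
  offset i + c       ∎)
  where open ≤-Reasoning

position-unique : ∀ {v i c i′ c′} → IsPosition v (i , c) → IsPosition v (i′ , c′) →
  (i , c) ≡ (i′ , c′)
position-unique {i = i} {c} {i′} {c′} p q with <-cmp i i′
... | tri< i<i′ _ _ = contradiction i<i′ (position-≮ p q)
... | tri> _ _ i′<i = contradiction i′<i (position-≮ q p)
... | tri≈ _ refl _ = cong (i ,_) (+-cancelˡ-≡ (offset i) c c′ (trans (proj₂ p) (sym (proj₂ q))))

-- The layered graph

data Vertex : Set where
  core : Fin 5 → Vertex
  cell : (layer index : ℕ) → Vertex

-- With the two cells of layer 0, which anchor attaches, this is an asymmetric
-- graph found by computer search.
coreArc : Fin 5 → Fin 5 → Bool
coreArc 0F 1F = true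
coreArc 0F 2F = true
coreArc 0F 4F = true
coreArc 2F 3F = true
coreArc _  _  = false

anchor : ℕ → Fin 5 → Bool
anchor 0 0F = true
anchor 0 1F = true
anchor 0 4F = true
anchor 1 1F = true
anchor 1 2F = true
anchor 1 3F = true
anchor _ _  = false

-- The cell of index c in layer i + 1 is joined to the non-empty set of cells
-- of layer i given by the binary digits of c + 1.
arc : Vertex → Vertex → Bool
arc (core i)   (core j)         = coreArc i j
arc (core i)   (cell zero c)    = anchor c i
arc (core i)   (cell (suc _) _) = false
arc (cell _ _) (core _)         = false
arc (cell i c) (cell j c′)      = (suc i ≡ᵇ j) ∧ digit c (suc c′)

joined : Vertex → Vertex → Bool
joined x y = arc x y ∨ arc y x

≡ᵇ-false : ∀ {i j} → i ≢ j → (i ≡ᵇ j) ≡ false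
≡ᵇ-false {zero}  {zero}  p = contradiction refl p
≡ᵇ-false {zero}  {suc j} p = refl
≡ᵇ-false {suc i} {zero}  p = refl
≡ᵇ-false {suc i} {suc j} p = ≡ᵇ-false (p ∘ cong suc)

≡ᵇ-true : ∀ i j → (i ≡ᵇ j) ≡ true → i ≡ j
≡ᵇ-true zero    zero    _ = refl
≡ᵇ-true (suc i) (suc j) p = cong suc (≡ᵇ-true i j p)

≡ᵇ-refl : ∀ i → (i ≡ᵇ i) ≡ true
≡ᵇ-refl zero    = refl
≡ᵇ-refl (suc i) = ≡ᵇ-refl i

arc-irrefl : ∀ x → arc x x ≡ false
arc-irrefl (core 0F) = refl
arc-irrefl (core 1F) = refl
arc-irrefl (core 2F) = refl
arc-irrefl (core 3F) = refl
arc-irrefl (core 4F) = refl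
arc-irrefl (cell i c) rewrite ≡ᵇ-false (1+n≢n {i}) = refl

joined-upward : ∀ {i l} c c′ → i < l → joined (cell i c) (cell l c′) ≡ (suc i ≡ᵇ l) ∧ digit c (suc c′)
joined-upward {i} {l} c c′ i<l
  rewrite ≡ᵇ-false {suc l} {i} (λ { refl → <-asym i<l (n<1+n l) }) = ∨-identityʳ _

joined⇒odd : ∀ i c j c′ → joined (cell i c) (cell j c′) ≡ true → odd j ≡ not (odd i)
joined⇒odd i c j c′ p with ∨-true⁻ {arc (cell i c) (cell j c′)} p
... | inj₁ q with refl ← ≡ᵇ-true (suc i) j (proj₁ (∧-true⁻ q)) = odd-suc i
... | inj₂ q with refl ← ≡ᵇ-true (suc j) i (proj₁ (∧-true⁻ q)) =
  trans (sym (not-involutive (odd j))) (cong not (sym (odd-suc j)))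

rank : Vertex → ℕ
rank (core _)   = 0
rank (cell i _) = i

-- Neighbours of a cell outside layer 0 are cells whose layer has the opposite
-- parity, so such a cell lies in no triangle.
triangle⇒rank≡0 : ∀ x y z → joined x y ≡ true → joined x z ≡ true → joined y z ≡ true → rank x ≡ 0
triangle⇒rank≡0 (core _)         _ _ _ _ _ = refl
triangle⇒rank≡0 (cell zero _)    _ _ _ _ _ = refl
triangle⇒rank≡0 (cell (suc i) c) (cell j d) (cell k e) p q r = contradiction
  (trans (joined⇒odd (suc i) c k e q) (sym (joined⇒odd (suc i) c j d p)))
  (λ same → not-¬ same (joined⇒odd j d k e r))

decode : ℕ → Vertex
decode 0 = core 0F
decode 1 = core 1F
decode 2 = core 2F
decode 3 = core 3F
decode 4 = core 4F
decode (suc (suc (suc (suc (suc v))))) = cell (proj₁ (position v)) (proj₂ (position v))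

decode-cell : ∀ v {i c} → decode v ≡ cell i c → c < width i × 5 + (offset i + c) ≡ v
decode-cell (suc (suc (suc (suc (suc v))))) refl =
  let p , q = isPosition v in p , cong (5 +_) q

decode-encode : ∀ {i c} → c < width i → decode (5 + (offset i + c)) ≡ cell i c
decode-encode {i} {c} c<w =
  cong (λ p → cell (proj₁ p) (proj₂ p)) (position-unique (isPosition (offset i + c)) (c<w , refl))

rank≡0⇒<7 : ∀ v → rank (decode v) ≡ 0 → v < 7
rank≡0⇒<7 0 _ = s≤s z≤n
rank≡0⇒<7 1 _ = s≤s (s≤s z≤n)
rank≡0⇒<7 2 _ = s≤s (s≤s (s≤s z≤n))
rank≡0⇒<7 3 _ = s≤s (s≤s (s≤s (s≤s z≤n)))
rank≡0⇒<7 4 _ = s≤s (s≤s (s≤s (s≤s (s≤s z≤n))))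
rank≡0⇒<7 (suc (suc (suc (suc (suc v))))) p = +-monoʳ-< 5 (lemma (position v) (isPosition v) p)
  where
  lemma : ∀ q → IsPosition v q → proj₁ q ≡ 0 → v < 2
  lemma (zero , c) (c<2 , refl) refl = c<2

-- All of layer `i` is numbered before any cell of layer `i + 1`, so the presence of such a cell
-- forces `tower i < n`.
rank≤log* : ∀ n v → v < n → rank (decode v) ≤ log* n
rank≤log* n v v<n = bound (decode v) refl
  where
  open ≤-Reasoning
  bound : ∀ x → decode v ≡ x → rank x ≤ log* n
  bound (core _)         _ = z≤n
  bound (cell zero _)    _ = z≤n
  bound (cell (suc i) c) e = ≮⇒≥ λ log*n≤i → <-irrefl refl (begin-strict
    n                        ≤⟨ ≤tower-log* n ⟩
    tower (log* n)           ≤⟨ tower-mono (s≤s⁻¹ log*n≤i) ⟩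
    tower i                  <⟨ tower<width i ⟩
    width i                  ≤⟨ m≤n+m (width i) (offset i) ⟩
    offset (suc i)            ≤⟨ m≤m+n (offset (suc i)) c ⟩
    offset (suc i) + c        ≤⟨ m≤n+m _ 5 ⟩
    5 + (offset (suc i) + c)  ≡⟨ proj₂ (decode-cell v e) ⟩
    v                        <⟨ v<n ⟩
    n                        ∎)

-- Induced on the first `n` vertices of one infinite graph; the topmost layer may be only partly
-- filled.
layered : ∀ n → Graph n
layered n = record
  { adj    = λ u v → joined (decode (toℕ u)) (decode (toℕ v))
  ; sym    = λ u v → ∨-comm (arc (decode (toℕ u)) (decode (toℕ v))) _
  ; irrefl = λ u → cong₂ _∨_ (arc-irrefl (decode (toℕ u))) (arc-irrefl (decode (toℕ u)))
  }

-- The rigid base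

module _ (G : Graph n) where

  Preserves : Fin n → Fin n → Fin n × Fin n → Set
  Preserves u x (v , y) = (x ≡ y → u ≡ v) × adj G u v ≡ adj G x y

  -- Rigidity as a backtracking search: a partial map grows one vertex at a time, and only
  -- extensions compatible with the earlier pairs are pursued. This keeps the decision by evaluation
  -- far smaller than a run over all maps.
  RigidFrom : List (Fin n × Fin n) → List (Fin n) → Set
  RigidFrom ps []       = All (λ p → proj₁ p ≡ proj₂ p) ps
  RigidFrom ps (u ∷ us) = ∀ x → All (Preserves u x) ps → RigidFrom ((u , x) ∷ ps) us

  rigidFrom? : ∀ ps us → Dec (RigidFrom ps us)
  rigidFrom? ps []       = All.all? (λ p → proj₁ p ≟ proj₂ p) ps
  rigidFrom? ps (u ∷ us) = all? λ x →
    All.all? (λ (v , y) → ((x ≟ y) →-dec (u ≟ v)) ×-dec (adj G u v Bool.≟ adj G x y)) ps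
      →-dec rigidFrom? ((u , x) ∷ ps) us

  rigidFrom⇒id : (g : Fin n → Fin n) → (∀ {u v} → g u ≡ g v → u ≡ v) →
    (∀ u v → adj G u v ≡ adj G (g u) (g v)) → ∀ ps us → All (λ p → g (proj₁ p) ≡ proj₂ p) ps →
    RigidFrom ps us → All (λ u → u ≡ g u) us × All (λ p → proj₁ p ≡ proj₂ p) ps
  rigidFrom⇒id g inj pres ps []       gs r = [] , r
  rigidFrom⇒id g inj pres ps (u ∷ us) gs r
    with rigidFrom⇒id g inj pres ((u , g u) ∷ ps) us (refl ∷ gs)
           (r (g u) (All.map (λ { {v , _} refl → inj , pres u v }) gs))
  ... | qs , (p ∷ qs′) = p ∷ qs , qs′

base-rigid : (g : Fin 7 → Fin 7) → (∀ {u v} → g u ≡ g v → u ≡ v) →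
  (∀ u v → adj (layered 7) u v ≡ adj (layered 7) (g u) (g v)) → ∀ u → u ≡ g u
base-rigid g inj pres u = All.lookup
  (proj₁ (rigidFrom⇒id (layered 7) g inj pres [] (allFin 7) []
           (from-yes (rigidFrom? (layered 7) [] (allFin 7)))))
  (∈-allFin u)

base-triangles : ∀ (u : Fin 7) → ∃ λ v → ∃ λ w → adj (layered 7) u v ≡ true ×
  adj (layered 7) u w ≡ true × adj (layered 7) v w ≡ true
base-triangles = from-yes (all? λ u → any? λ v → any? λ w →
  (adj (layered 7) u v Bool.≟ true) ×-dec (adj (layered 7) u w Bool.≟ true)
    ×-dec (adj (layered 7) v w Bool.≟ true))

-- Naming the vertices layer by layer, and the upper bound.

module _ {n : ℕ} (7≤n : 7 ≤ n) where

  private G = layered n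

  ι : Fin 7 → Fin n
  ι i = inject≤ i 7≤n

  adj-ι : ∀ i j → adj (layered 7) i j ≡ adj G (ι i) (ι j)
  adj-ι i j = cong₂ (λ u v → joined (decode u) (decode v))
    (sym (toℕ-inject≤ i 7≤n)) (sym (toℕ-inject≤ j 7≤n))

  -- Spoiler plays the seven base vertices. Their triangles force the replies into the base, and
  -- rigidity makes each reply equal to the move. As `v` is one of the seven, `w` must be `v`.
  base-named : ∀ v → rank (decode (toℕ v)) ≡ 0 → Named G 7 v
  base-named v rank≡0 w s = trans (sym ιi≡v) (trans (h≡ι i) (same-≡⇒ {G = G} {G} (h-v i zero) ιi≡v))
    where
    played = play {G = G} {G} 7 ι s
    h : Fin 7 → Fin n
    h = proj₁ played
    h-same : ∀ i j → SameAtoms G G (ι i) (ι j) (h i) (h j)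
    h-same = proj₁ (proj₂ played)
    h-v = proj₁ (proj₂ (proj₂ played))
    adj-h : ∀ i j → adj (layered 7) i j ≡ adj G (h i) (h j)
    adj-h i j = trans (adj-ι i j) (proj₂ (h-same i j))
    h<7 : ∀ i → toℕ (h i) < 7
    h<7 i = let j , k , p , q , r = base-triangles i in
      rank≡0⇒<7 (toℕ (h i)) (triangle⇒rank≡0 _ (decode (toℕ (h j))) (decode (toℕ (h k)))
        (trans (sym (adj-h i j)) p) (trans (sym (adj-h i k)) q) (trans (sym (adj-h j k)) r))
    g : Fin 7 → Fin 7
    g i = fromℕ< (h<7 i)
    toℕ-g : ∀ i → toℕ (g i) ≡ toℕ (h i)
    toℕ-g i = toℕ-fromℕ< (h<7 i)
    g-injective : ∀ {i j} → g i ≡ g j → i ≡ j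
    g-injective {i} {j} e = toℕ-injective (trans (sym (toℕ-inject≤ i 7≤n)) (trans (cong toℕ
      (same-≡⇐ {G = G} {G} (h-same i j)
        (toℕ-injective (trans (sym (toℕ-g i)) (trans (cong toℕ e) (toℕ-g j))))))
      (toℕ-inject≤ j 7≤n)))
    g-adj : ∀ i j → adj (layered 7) i j ≡ adj (layered 7) (g i) (g j)
    g-adj i j = trans (adj-h i j) (cong₂ (λ u v → joined (decode u) (decode v))
      (sym (toℕ-g i)) (sym (toℕ-g j)))
    h≡ι : ∀ i → ι i ≡ h i
    h≡ι i = toℕ-injective (trans (toℕ-inject≤ i 7≤n)
      (trans (cong toℕ (base-rigid g g-injective g-adj i)) (toℕ-g i)))
    v<7 = rank≡0⇒<7 (toℕ v) rank≡0
    i = fromℕ< v<7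
    ιi≡v : ι i ≡ v
    ιi≡v = toℕ-injective (trans (toℕ-inject≤ i 7≤n) (toℕ-fromℕ< v<7))

  -- Within layer `i + 1` the neighbours in layer `i` spell out the index in binary. A cell of a
  -- higher layer has no neighbour in layer `i`, whereas `v` has one because its code `suc c` is
  -- nonzero.
  layer-separated : ∀ i (v w : Fin n) → rank (decode (toℕ v)) ≡ suc i → i < rank (decode (toℕ w)) →
    (∀ u → rank (decode (toℕ u)) ≤ i → adj G u v ≡ adj G u w) → v ≡ w
  layer-separated i v w rank-v rank-w agree =
    separate (decode (toℕ v)) (decode (toℕ w)) refl refl rank-v rank-w
    where
    separate : ∀ x y → decode (toℕ v) ≡ x → decode (toℕ w) ≡ y → rank x ≡ suc i → i < rank y → v ≡ w
    separate (cell _ c) (cell l c′) dv dw refl i<l = conclude (l ℕ.≟ suc i)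
      where
      c<  = proj₁ (decode-cell (toℕ v) dv)
      c′< = proj₁ (decode-cell (toℕ w) dw)
      -- Layer `i` is complete in `layered n`, since `v` is numbered after all of it.
      below : ∀ {j} → j < width i → 5 + (offset i + j) < n
      below {j} j<w = begin-strict
        5 + (offset i + j)        <⟨ +-monoʳ-< 5 (+-monoʳ-< (offset i) j<w) ⟩
        5 + offset (suc i)        ≤⟨ +-monoʳ-≤ 5 (m≤m+n (offset (suc i)) c) ⟩
        5 + (offset (suc i) + c)  ≡⟨ proj₂ (decode-cell (toℕ v) dv) ⟩
        toℕ v                    <⟨ toℕ<n v ⟩
        n                        ∎
        where open ≤-Reasoning
      digits : ∀ {j} → j < width i → digit j (suc c) ≡ (suc i ≡ᵇ l) ∧ digit j (suc c′)
      digits {j} j<w = begin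
        digit j (suc c)                          ≡⟨ cong (_∧ digit j (suc c)) (sym (≡ᵇ-refl (suc i))) ⟩
        (suc i ≡ᵇ suc i) ∧ digit j (suc c)       ≡⟨ sym (joined-upward j c (n<1+n i)) ⟩
        joined (cell i j) (cell (suc i) c)       ≡⟨ cong₂ joined (sym du) (sym dv) ⟩
        adj G u v                                ≡⟨ agree u (≤-reflexive (cong rank du)) ⟩
        adj G u w                                ≡⟨ cong₂ joined du dw ⟩
        joined (cell i j) (cell l c′)            ≡⟨ joined-upward j c′ i<l ⟩
        (suc i ≡ᵇ l) ∧ digit j (suc c′)          ∎
        where
        open ≡-Reasoning
        u : Fin n
        u = fromℕ< (below j<w)
        du : decode (toℕ u) ≡ cell i j
        du = trans (cong decode (toℕ-fromℕ< (below j<w))) (decode-encode j<w)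
      code< : ∀ {c} → c < width (suc i) → suc c < 2 ^ width i
      code< = m<pred[n]⇒suc[m]<n
        where
        m<pred[n]⇒suc[m]<n : ∀ {m n} → m < pred n → suc m < n
        m<pred[n]⇒suc[m]<n {n = suc n} p = s≤s p
      conclude : Dec (l ≡ suc i) → v ≡ w
      conclude (yes refl) = toℕ-injective (trans (sym (proj₂ (decode-cell (toℕ v) dv)))
        (trans (cong (λ c → 5 + (offset (suc i) + c)) c≡c′) (proj₂ (decode-cell (toℕ w) dw))))
        where
        c≡c′ : c ≡ c′
        c≡c′ = ℕ.suc-injective (digits-injective (width i) (code< c<) (code< c′<) λ {j} j<w →
          trans (digits j<w) (cong (_∧ digit j (suc c′)) (≡ᵇ-refl (suc i))))
      -- All digits of `suc c` vanish, which would make it `0`.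
      conclude (no l≢) = contradiction
        (digits-injective (width i) (code< c<) (m^n>0 2 (width i)) λ {j} j<w →
          trans (digits j<w) (trans (cong (_∧ digit j (suc c′)) (≡ᵇ-false (l≢ ∘ sym)))
            (sym (digit-zero j))))
        λ ()

  -- Each layer costs one move. If `w` lies in layer `i` or below, Spoiler plays `w`, already named;
  -- otherwise his move on any named lower vertex shows that `v` and `w` have the same lower
  -- neighbours.
  layers-named : ∀ i v → rank (decode (toℕ v)) ≤ i → Named G (i + 7) v
  layers-named zero    v p = base-named v (n≤0⇒n≡0 p)
  layers-named (suc i) v p w s with m≤n⇒m<n∨m≡n p
  ... | inj₁ rank-v≤i = layers-named i v (s≤s⁻¹ rank-v≤i) w (sim-weaken (i + 7) s)
  ... | inj₂ rank-v   with rank (decode (toℕ w)) ≤? i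
  ...   | yes rank-w≤i = sym (same-≡⇐ {G = G} {G}
    (named⇒same (i + 7) (layers-named i w rank-w≤i) s) refl)
  ...   | no rank-w≰i = layer-separated i v w rank-v (≰⇒> rank-w≰i)
    (λ u q → proj₂ (named⇒same (i + 7) (layers-named i u q) s))

-- From 7 vertices on the base is complete and depth `log* (suc n) + 9` suffices. Smaller graphs are
-- defined by listing all vertices, at depth at most `7`.
upper-bound : ∀ n → Σ (Graph (suc n)) λ G → Σ Sentence λ Φ →
  ZeroAlt Φ × Defines Φ G × depth Φ ≤ log* (suc n) + 22
upper-bound n with 7 ≤? suc n
... | yes 7≤n = G , define G (suc d) , define-zeroAlt G (suc d) ,
    define-defines G (suc d) (λ m H → named⇒iso G H d named) ,
    ≤-trans (define-depth G (suc d)) (begin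
      2 + (log* (suc n) + 7)  ≡⟨ +-comm 2 (log* (suc n) + 7) ⟩
      log* (suc n) + 7 + 2    ≡⟨ +-assoc (log* (suc n)) 7 2 ⟩
      log* (suc n) + 9        ≤⟨ +-monoʳ-≤ (log* (suc n)) (m≤m+n 9 13) ⟩
      log* (suc n) + 22       ∎)
  where
  open ≤-Reasoning
  G = layered (suc n)
  d = log* (suc n) + 7
  named : ∀ v → Named G d v
  named v = layers-named 7≤n (log* (suc n)) v (rank≤log* (suc n) (toℕ v) (toℕ<n v))
... | no 7≰n = G , define G (suc n) , define-zeroAlt G (suc n) ,
    define-defines G (suc n) (λ m H → size-rounds⇒iso G H) ,
    ≤-trans (define-depth G (suc n)) (begin
      2 + n              ≤⟨ ≰⇒> 7≰n ⟩
      7                  ≤⟨ m≤m+n 7 15 ⟩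
      22                 ≤⟨ m≤n+m 22 (log* (suc n)) ⟩
      log* (suc n) + 22  ∎)
  where
  open ≤-Reasoning
  G = layered (suc n)

theorem1 : ∀ (n : ℕ) → 1 ≤ n →
    ((G : Graph n) (Φ : Sentence) → ZeroAlt Φ → Defines Φ G →
    log* n ≤ depth Φ + log* (log* n) + 1)
    × Σ (Graph n) (λ G → Σ Sentence (λ Φ →
    ZeroAlt Φ × Defines Φ G × depth Φ ≤ log* n + 22))
theorem1 (suc n) _ = lower-bound n , upper-bound n
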